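{- Let $N=pq$ with $p,q$ distinct primes. Let $d\in\mathbb{N}$ and $b_1,\dots,b_d\in\mathbb{Z}$. For each $i$ let $f_i=l_iX+c_i\in\mathbb{Z}[X]$ be a polynomial of degree $1$ with $f_i(b_i)=N$. If $\gcd(c_i,N)=1$ for every $i$ and $\gcd(b_j-b_k,N)=1$ for all $j,k\in\{1,\dots,d\}$ with $j\neq k$, then \[\nu\Big(\prod_{i=1}^d f_i\Big)=dp+dq-2d^2.\]
   Context: $Z_N=\{0,1,\dots,N-1\}$. For $g\in\mathbb{Z}[X]$, an element $x\in Z_N$ is called suitable for $g$ if $1<\gcd(g(x),N)<N$, and $\nu(g)$ denotes the number of $x\in Z_N$ suitable for $g$. -}

module Defs where

open import Data.Fin using (Fin)
open import Data.Integer using (ℤ; +_; 0ℤ; 1ℤ; _+_; _*_; _<_)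
open import Data.Integer.GCD using (gcd)
open import Data.Integer.Properties using (_<?_)
open import Data.List using (List; []; _∷_; map; length; filter; upTo)
open import Data.Nat as ℕ using (ℕ; zero; suc)
open import Data.Product using (_×_)
open import Data.Vec.Functional using (foldr)
open import Relation.Binary.PropositionalEquality using (_≡_; _≢_)
open import Relation.Nullary.Decidable using (Dec; _×-dec_)

-- ℤ[X] as coefficient lists, constant term first.  Trailing zeros are
-- allowed, so a polynomial has several representatives; `coeff` and `eval`
-- agree on all of them, hence so do `HasDegree` and `ν`.
Poly : Set
Poly = List ℤ

coeff : Poly → ℕ → ℤ
coeff []      _       = 0ℤ
coeff (a ∷ _) zero    = a
coeff (_ ∷ g) (suc n) = coeff g n

HasDegree : Poly → ℕ → Set
HasDegree g n = coeff g n ≢ 0ℤ × (∀ m → n ℕ.< m → coeff g m ≡ 0ℤ)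

eval : Poly → ℤ → ℤ
eval []      x = 0ℤ
eval (a ∷ g) x = a + x * eval g x

linear : ℤ → ℤ → Poly
linear l c = c ∷ l ∷ []

infixl 6 _+ₚ_
infixl 7 _*ₚ_

_+ₚ_ : Poly → Poly → Poly
[]      +ₚ h       = h
(a ∷ g) +ₚ []      = a ∷ g
(a ∷ g) +ₚ (b ∷ h) = (a + b) ∷ (g +ₚ h)

-- (a + X g) h = a h + X (g h)
_*ₚ_ : Poly → Poly → Poly
[]      *ₚ h = []
(a ∷ g) *ₚ h = map (a *_) h +ₚ (0ℤ ∷ (g *ₚ h))

∏ : ∀ {d} → (Fin d → Poly) → Poly
∏ = foldr _*ₚ_ (1ℤ ∷ [])

Suitable : ℕ → Poly → ℕ → Set
Suitable N g x = 1ℤ < gcd (eval g (+ x)) (+ N) × gcd (eval g (+ x)) (+ N) < + N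

suitable? : ∀ N g x → Dec (Suitable N g x)
suitable? N g x =
  (1ℤ <? gcd (eval g (+ x)) (+ N)) ×-dec (gcd (eval g (+ x)) (+ N) <? + N)

-- `upTo N` lists 0, 1, …, N - 1, each once.
ν : ℕ → Poly → ℕ
ν N g = length (filter (suitable? N g) (upTo N))

{-# OPTIONS --safe #-}
module Submission where

-- Write fᵢ(x) = N + lᵢ(x - bᵢ).  A prime divisor p of N does not divide lᵢ, for
-- otherwise it would divide cᵢ; hence p ∣ fᵢ(x) iff x ≡ bᵢ mod p, and since
-- the bᵢ are distinct mod p the indicator [p ∣ f(x)] equals Σᵢ [p ∣ x - bᵢ].
-- Now x is suitable iff exactly one of p, q divides f(x), that is
--   [x suitable] + 2 [p ∣ f(x)] [q ∣ f(x)] = [p ∣ f(x)] + [q ∣ f(x)].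
-- Summing over x < N, each [p ∣ x - bᵢ] contributes q, each [q ∣ x - bⱼ]
-- contributes p, and each product [p ∣ x - bᵢ] [q ∣ x - bⱼ] contributes 1 by
-- the Chinese remainder theorem.

open import Defs
open import Data.Fin as Fin using (Fin; zero; suc; toℕ)
import Data.Fin.Properties as Fin
open import Data.Integer using (ℤ; +_; 0ℤ; 1ℤ; ∣_∣; +<+; _+_; _-_; _*_; _^_; -_)
open import Data.Integer.GCD using (gcd; gcd-greatest)
open import Data.Integer.DivMod using (_%ℕ_; _/ℕ_; n%ℕd<d; a≡a%ℕn+[a/ℕn]*n)
open import Data.Integer.Divisibility.Signed
open import Data.Integer.Properties as ℤ using (drop‿+<+; abs-*; pos-*; m-n≡m⊖n)
open import Data.Integer.Tactic.RingSolver using (solve-∀)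
open import Data.List using (_∷_; []; length; filter; map; applyUpTo)
open import Data.Nat as ℕ using (ℕ)
import Data.Nat.Divisibility as ℕ
import Data.Nat.GCD as ℕ
import Data.Nat.Properties as ℕ
open import Data.Nat.Coprimality using (Coprime; coprime-Bézout; coprime-divisor)
open import Data.Nat.Primality
  using (Prime; euclidsLemma; prime⇒irreducible; prime⇒nonZero; prime⇒nonTrivial)
open import Data.Product using (∃; _×_; _,_; proj₁; proj₂)
open import Data.Sum as Sum using (_⊎_; inj₁; inj₂; [_,_]′)
open import Function using (_∘_; _⇔_; mk⇔; Equivalence)
open import Level using (Level)
open import Relation.Binary.PropositionalEquality
  using (_≡_; _≢_; refl; sym; trans; cong; cong₂; subst; subst₂; module ≡-Reasoning)
open import Relation.Nullary using (¬_; Dec; yes; no; contradiction)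
open import Relation.Nullary.Decidable using (_×-dec_)
open import Relation.Unary using (Pred; Decidable)
open import Algebra.Properties.Semiring.Sum ℕ.+-*-semiring
  using (sum; sum-syntax; sum-cong-≗; ∑-distrib-+; ∑-comm; *-distribˡ-sum; *-distribʳ-sum)

-- Indicators of decidable propositions and finite sums of them.

private
  variable
    a b c : Level
    P : Set a
    Q : Set b

[_] : Dec P → ℕ
[ yes _ ] = 1
[ no _ ]  = 0

[]-cong : P ⇔ Q → (P? : Dec P) (Q? : Dec Q) → [ P? ] ≡ [ Q? ]
[]-cong _   (yes _) (yes _) = refl
[]-cong P⇔Q (yes p) (no ¬q) = contradiction (Equivalence.to P⇔Q p) ¬q
[]-cong P⇔Q (no ¬p) (yes q) = contradiction (Equivalence.from P⇔Q q) ¬p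
[]-cong _   (no _)  (no _)  = refl

[]-× : (P? : Dec P) (Q? : Dec Q) → [ P? ] ℕ.* [ Q? ] ≡ [ P? ×-dec Q? ]
[]-× (yes _) (yes _) = refl
[]-× (yes _) (no _)  = refl
[]-× (no _)  _       = refl

[]-yes : P → (P? : Dec P) → [ P? ] ≡ 1
[]-yes p (yes _) = refl
[]-yes p (no ¬p) = contradiction p ¬p

[]-no : ¬ P → (P? : Dec P) → [ P? ] ≡ 0
[]-no ¬p (yes p) = contradiction p ¬p
[]-no _  (no _)  = refl

-- The four case hypotheses say that `R` is the exclusive or of `P` and `Q`. Adding `2 [P][Q]` on
-- the left, rather than subtracting it on the right, avoids truncated subtraction in `ℕ`.
[]-exactlyOne : {R : Set c} (P? : Dec P) (Q? : Dec Q) (R? : Dec R) →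
                (P → Q → ¬ R) → (P → ¬ Q → R) → (¬ P → Q → R) → (¬ P → ¬ Q → ¬ R) →
                [ R? ] ℕ.+ 2 ℕ.* ([ P? ] ℕ.* [ Q? ]) ≡ [ P? ] ℕ.+ [ Q? ]
[]-exactlyOne (yes p) (yes q) R? both _ _ _ = cong (ℕ._+ 2) ([]-no (both p q) R?)
[]-exactlyOne (yes p) (no ¬q) R? _ onlyP _ _ = cong (ℕ._+ 0) ([]-yes (onlyP p ¬q) R?)
[]-exactlyOne (no ¬p) (yes q) R? _ _ onlyQ _ = cong (ℕ._+ 0) ([]-yes (onlyQ ¬p q) R?)
[]-exactlyOne (no ¬p) (no ¬q) R? _ _ _ none = cong (ℕ._+ 0) ([]-no (none ¬p ¬q) R?)

∑-const : ∀ n k → ∑[ i < n ] k ≡ n ℕ.* k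
∑-const ℕ.zero    k = refl
∑-const (ℕ.suc n) k = cong (k ℕ.+_) (∑-const n k)

∑-[]≡0 : ∀ {n} {P : Pred (Fin n) a} (P? : Decidable P) → ¬ ∃ P → ∑[ i < n ] [ P? i ] ≡ 0
∑-[]≡0 {n = n} P? ¬∃ =
  trans (sum-cong-≗ λ i → []-no (λ p → ¬∃ (i , p)) (P? i)) (trans (∑-const n 0) (ℕ.*-zeroʳ n))

-- At most one summand is 1, so once a witness is met the remaining sum vanishes. The decision is an
-- argument because one use supplies an explicit witness and another a search over `Fin`.
∑-[]-unique : ∀ {n} {P : Pred (Fin n) a} (P? : Decidable P) → (∀ {i j} → P i → P j → i ≡ j) →
              (∃P? : Dec (∃ P)) → ∑[ i < n ] [ P? i ] ≡ [ ∃P? ]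
∑-[]-unique P? _ (no ¬∃P) = ∑-[]≡0 P? ¬∃P
∑-[]-unique {n = ℕ.suc n} P? unique (yes (i , pᵢ)) with P? zero
... | yes p₀ = cong ℕ.suc (∑-[]≡0 (P? ∘ suc) λ (j , pⱼ) → Fin.0≢1+n (unique p₀ pⱼ))
... | no ¬p₀ with i
...   | zero  = contradiction pᵢ ¬p₀
...   | suc j = ∑-[]-unique (P? ∘ suc) (λ p q → Fin.suc-injective (unique p q)) (yes (j , pᵢ))

∑-split : ∀ m n (f : ℕ → ℕ) →
          ∑[ i < m ℕ.+ n ] f (toℕ i) ≡ ∑[ i < m ] f (toℕ i) ℕ.+ ∑[ i < n ] f (m ℕ.+ toℕ i)
∑-split ℕ.zero    n f = refl
∑-split (ℕ.suc m) n f =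
  trans (cong (f 0 ℕ.+_) (∑-split m n (f ∘ ℕ.suc))) (sym (ℕ.+-assoc (f 0) _ _))

∑-product : ∀ m n (f : Fin m → ℕ) (g : Fin n → ℕ) →
            sum f ℕ.* sum g ≡ ∑[ i < m ] ∑[ j < n ] (f i ℕ.* g j)
∑-product m n f g =
  trans (*-distribʳ-sum (sum g) f) (sum-cong-≗ λ i → *-distribˡ-sum (f i) g)

-- The general `f` is for the induction: the tail of `applyUpTo f` is `applyUpTo (f ∘ ℕ.suc)`. The
-- case of the identity is `upTo`, hence `ν`.
length-filter-applyUpTo : {P : Pred ℕ a} (P? : Decidable P) (f : ℕ → ℕ) → ∀ n →
                          length (filter P? (applyUpTo f n)) ≡ ∑[ i < n ] [ P? (f (toℕ i)) ]
length-filter-applyUpTo P? f ℕ.zero    = refl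
length-filter-applyUpTo P? f (ℕ.suc n) with P? (f 0)
... | yes _ = cong ℕ.suc (length-filter-applyUpTo P? (f ∘ ℕ.suc) n)
... | no _  = length-filter-applyUpTo P? (f ∘ ℕ.suc) n

-- Counting a residue class in an initial segment of the naturals.

∣⇒<⇒≡0 : ∀ {m n} → n ℕ.∣ m → m ℕ.< n → m ≡ 0
∣⇒<⇒≡0 {ℕ.zero}  _   _   = refl
∣⇒<⇒≡0 {ℕ.suc m} n∣m m<n = contradiction (ℕ.∣⇒≤ n∣m) (ℕ.<⇒≱ m<n)

-- Two numbers below `n` differ in absolute value by at most their maximum, so by less than `n`, and
-- the only such multiple of `n` is 0.
residue-unique : ∀ {n} {i j : Fin n} → + n ∣ + toℕ i - + toℕ j → i ≡ j
residue-unique {n} {i} {j} n∣i-j = Fin.toℕ-injective (ℤ.+-injective (ℤ.i-j≡0⇒i≡j _ _ i-j≡0))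
  where
  ∣i-j∣<n : ∣ + toℕ i - + toℕ j ∣ ℕ.< n
  ∣i-j∣<n = subst (λ z → ∣ z ∣ ℕ.< n) (sym (m-n≡m⊖n (toℕ i) (toℕ j)))
    (ℕ.≤-<-trans (ℤ.∣m⊝n∣≤m⊔n (toℕ i) (toℕ j)) (ℕ.⊔-lub (Fin.toℕ<n i) (Fin.toℕ<n j)))
  i-j≡0 : + toℕ i - + toℕ j ≡ 0ℤ
  i-j≡0 = ℤ.∣i∣≡0⇒i≡0 (∣⇒<⇒≡0 (∣⇒∣ᵤ n∣i-j) ∣i-j∣<n)

∣-difference : ∀ {k} x y z → k ∣ x - z → k ∣ y - z → k ∣ x - y
∣-difference {k} x y z k∣x-z k∣y-z = subst (k ∣_) (eq x y z) (∣m∣n⇒∣m-n k∣x-z k∣y-z)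
  where
  eq : ∀ x y z → (x - z) - (y - z) ≡ x - y
  eq = solve-∀

∣-difference′ : ∀ {k} x y z → k ∣ x - y → k ∣ x - z → k ∣ y - z
∣-difference′ {k} x y z k∣x-y k∣x-z = subst (k ∣_) (eq x y z) (∣m∣n⇒∣m-n k∣x-z k∣x-y)
  where
  eq : ∀ x y z → (x - z) - (x - y) ≡ y - z
  eq = solve-∀

∑-multiples-block : ∀ n .{{_ : ℕ.NonZero n}} r → ∑[ x < n ] [ + n ∣? + toℕ x - r ] ≡ 1
∑-multiples-block n r = ∑-[]-unique (λ x → + n ∣? + toℕ x - r)
  (λ {i} {j} p q → residue-unique (∣-difference (+ toℕ i) (+ toℕ j) r p q))
  -- The witness is the remainder of `r`: subtracting `r` from it leaves minus the quotient times
  -- `n`.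
  (yes (Fin.fromℕ< r%n<n , divides (- (r /ℕ n)) remainder))
  where
  r%n<n = n%ℕd<d r n
  eq : ∀ s t → s - (s + t) ≡ - t
  eq = solve-∀
  open ≡-Reasoning
  remainder : + toℕ (Fin.fromℕ< r%n<n) - r ≡ - (r /ℕ n) * + n
  remainder = begin
    + toℕ (Fin.fromℕ< r%n<n) - r                    ≡⟨ cong₂ (λ s t → + s - t) (Fin.toℕ-fromℕ< r%n<n) (a≡a%ℕn+[a/ℕn]*n r n) ⟩
    + (r %ℕ n) - (+ (r %ℕ n) + (r /ℕ n) * + n)      ≡⟨ eq (+ (r %ℕ n)) ((r /ℕ n) * + n) ⟩
    - ((r /ℕ n) * + n)                              ≡⟨ ℤ.neg-distribˡ-* (r /ℕ n) (+ n) ⟩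
    - (r /ℕ n) * + n                                ∎

-- The range is cut into `k` blocks of length `n`. Translating past the first block is absorbed by
-- replacing `r` with `r - n`, so the induction needs every `r`.
∑-multiples : ∀ k n .{{_ : ℕ.NonZero n}} r → ∑[ x < k ℕ.* n ] [ + n ∣? + toℕ x - r ] ≡ k
∑-multiples ℕ.zero    n r = refl
∑-multiples (ℕ.suc k) n r = begin
  ∑[ x < n ℕ.+ k ℕ.* n ] [ + n ∣? + toℕ x - r ]
    ≡⟨ ∑-split n (k ℕ.* n) (λ x → [ + n ∣? + x - r ]) ⟩
  ∑[ x < n ] [ + n ∣? + toℕ x - r ] ℕ.+ ∑[ x < k ℕ.* n ] [ + n ∣? + (n ℕ.+ toℕ x) - r ]
    ≡⟨ cong₂ ℕ._+_ (∑-multiples-block n r)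
         (sum-cong-≗ {k ℕ.* n} λ x → cong (λ z → [ + n ∣? z ]) (shift (+ n) (+ toℕ x) r)) ⟩
  1 ℕ.+ ∑[ x < k ℕ.* n ] [ + n ∣? + toℕ x - (r - + n) ]
    ≡⟨ cong ℕ.suc (∑-multiples k n (r - + n)) ⟩
  ℕ.suc k ∎
  where
  open ≡-Reasoning
  shift : ∀ n x r → (n + x) - r ≡ x - (r - n)
  shift = solve-∀

-- Bézout coefficients and the Chinese remainder theorem.

coprime-*-∣ : ∀ {m n k} → Coprime m n → + m ∣ k → + n ∣ k → + (m ℕ.* n) ∣ k
coprime-*-∣ {m} {n} m⊥n m∣k n∣k with ∣⇒∣ᵤ m∣k
... | ℕ.divides c eq = ∣ᵤ⇒∣ (subst₂ ℕ._∣_ (ℕ.*-comm n m) (sym eq) (ℕ.*-monoˡ-∣ m n∣c))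
  where
  -- Here `∣ k ∣` is `c ℕ.* m`, and `n` is coprime to `m`, so it must divide the cofactor.
  n∣c : n ℕ.∣ c
  n∣c = coprime-divisor (λ (d∣n , d∣m) → m⊥n (d∣m , d∣n))
    (subst (n ℕ.∣_) (trans eq (ℕ.*-comm c m)) (∣⇒∣ᵤ n∣k))

pos-identity : ∀ x m y n → 1 ℕ.+ y ℕ.* n ≡ x ℕ.* m → + x * + m ≡ 1ℤ + + y * + n
pos-identity x m y n eq = trans (sym (pos-* x m)) (trans (cong +_ (sym eq)) (cong (λ z → 1ℤ + z) (pos-* y n)))

-- Over `ℕ` the identity comes in two forms, according to which coefficient would be negative; signs
-- in `ℤ` merge them.
bézout : ∀ {m n} → Coprime m n → ∃ λ s → ∃ λ t → s * + m + t * + n ≡ 1ℤ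
bézout {m} {n} m⊥n with coprime-Bézout m⊥n
... | ℕ.Bézout.+- x y eq = + x , - + y , trans (cong (_+ - + y * + n) (pos-identity x m y n eq)) (cancelʳ (+ y) (+ n))
  where
  cancelʳ : ∀ y n → (1ℤ + y * n) + - y * n ≡ 1ℤ
  cancelʳ = solve-∀
... | ℕ.Bézout.-+ x y eq = - + x , + y , trans (cong (λ z → - + x * + m + z) (pos-identity y n x m eq)) (cancelˡ (+ x) (+ m))
  where
  cancelˡ : ∀ x m → - x * m + (1ℤ + x * m) ≡ 1ℤ
  cancelˡ = solve-∀

-- The solution `u + s m (v - u)` is visibly `u` mod `m`; mod `n` it is `v`, because `s m` is 1
-- there.
chineseRemainder : ∀ {m n} → Coprime m n → ∀ u v → ∃ λ r → (+ m ∣ r - u) × (+ n ∣ r - v)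
chineseRemainder {m} {n} m⊥n u v with bézout m⊥n
... | s , t , sm+tn≡1 = u + s * + m * (v - u) , divides (s * (v - u)) (mod-m u v s (+ m)) ,
    divides (t * (u - v)) (begin
      u + s * + m * (v - u) - v                          ≡⟨ expand u v (s * + m) ⟩
      -- With 1 written as `s m + t n`, the terms in `s m` cancel and a multiple of `n` is left.
      1ℤ * (u - v) + s * + m * (v - u)                   ≡⟨ cong (λ e → e * (u - v) + s * + m * (v - u)) (sym sm+tn≡1) ⟩
      (s * + m + t * + n) * (u - v) + s * + m * (v - u)  ≡⟨ mod-n u v (s * + m) t (+ n) ⟩
      t * (u - v) * + n                                  ∎)
  where
  open ≡-Reasoning
  mod-m : ∀ u v s m → (u + s * m * (v - u)) - u ≡ s * (v - u) * m
  mod-m = solve-∀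
  expand : ∀ u v e → (u + e * (v - u)) - v ≡ 1ℤ * (u - v) + e * (v - u)
  expand = solve-∀
  mod-n : ∀ u v e t n → (e + t * n) * (u - v) + e * (v - u) ≡ t * (u - v) * n
  mod-n = solve-∀

-- A common solution `r` turns the two congruences into the single one `x ≡ r` mod `m n`, and the
-- range is exactly one block of that length.
∑-simultaneous : ∀ {m n} .{{_ : ℕ.NonZero (m ℕ.* n)}} → Coprime m n → ∀ u v →
                 ∑[ x < m ℕ.* n ] ([ + m ∣? + toℕ x - u ] ℕ.* [ + n ∣? + toℕ x - v ]) ≡ 1
∑-simultaneous {m} {n} m⊥n u v =
  trans (sum-cong-≗ {m ℕ.* n} λ x → step (+ toℕ x)) (∑-multiples-block (m ℕ.* n) r)
  where
  r = proj₁ (chineseRemainder m⊥n u v)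
  m∣r-u : + m ∣ r - u
  m∣r-u = proj₁ (proj₂ (chineseRemainder m⊥n u v))
  n∣r-v : + n ∣ r - v
  n∣r-v = proj₂ (proj₂ (chineseRemainder m⊥n u v))
  chain : ∀ x y z → (x - y) + (y - z) ≡ x - z
  chain = solve-∀
  to : ∀ x → (+ m ∣ x - u) × (+ n ∣ x - v) → + (m ℕ.* n) ∣ x - r
  to x (m∣x-u , n∣x-v) =
    coprime-*-∣ m⊥n (∣-difference x r u m∣x-u m∣r-u) (∣-difference x r v n∣x-v n∣r-v)
  from : ∀ x → + (m ℕ.* n) ∣ x - r → (+ m ∣ x - u) × (+ n ∣ x - v)
  from x mn∣x-r =
    subst (+ m ∣_) (chain x r u) (∣m∣n⇒∣m+n (∣-trans (∣ᵤ⇒∣ (ℕ.m∣m*n n)) mn∣x-r) m∣r-u) ,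
    subst (+ n ∣_) (chain x r v) (∣m∣n⇒∣m+n (∣-trans (∣ᵤ⇒∣ (ℕ.n∣m*n m)) mn∣x-r) n∣r-v)
  step : ∀ x → [ + m ∣? x - u ] ℕ.* [ + n ∣? x - v ] ≡ [ + (m ℕ.* n) ∣? x - r ]
  step x = trans ([]-× m? n?) ([]-cong (mk⇔ (to x) (from x)) (m? ×-dec n?) (+ (m ℕ.* n) ∣? x - r))
    where
    m? = + m ∣? x - u
    n? = + n ∣? x - v

-- Evaluation of sums and products of polynomials.

eval-map-* : ∀ c h x → eval (map (c *_) h) x ≡ c * eval h x
eval-map-* c []      x = sym (ℤ.*-zeroʳ c)
eval-map-* c (a ∷ h) x = trans (cong (λ z → c * a + x * z) (eval-map-* c h x)) (eq c a x (eval h x))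
  where
  eq : ∀ c a x y → c * a + x * (c * y) ≡ c * (a + x * y)
  eq = solve-∀

eval-+ₚ : ∀ g h x → eval (g +ₚ h) x ≡ eval g x + eval h x
eval-+ₚ []      h       x = sym (ℤ.+-identityˡ _)
eval-+ₚ (a ∷ g) []      x = sym (ℤ.+-identityʳ _)
eval-+ₚ (a ∷ g) (b ∷ h) x =
  trans (cong (λ z → a + b + x * z) (eval-+ₚ g h x)) (eq a b x (eval g x) (eval h x))
  where
  eq : ∀ a b x y z → a + b + x * (y + z) ≡ (a + x * y) + (b + x * z)
  eq = solve-∀

eval-*ₚ : ∀ g h x → eval (g *ₚ h) x ≡ eval g x * eval h x
eval-*ₚ []      h x = refl
eval-*ₚ (a ∷ g) h x = begin
  eval (map (a *_) h +ₚ (0ℤ ∷ (g *ₚ h))) x            ≡⟨ eval-+ₚ (map (a *_) h) (0ℤ ∷ (g *ₚ h)) x ⟩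
  eval (map (a *_) h) x + (0ℤ + x * eval (g *ₚ h) x)  ≡⟨ cong₂ (λ y z → y + (0ℤ + x * z)) (eval-map-* a h x) (eval-*ₚ g h x) ⟩
  a * eval h x + (0ℤ + x * (eval g x * eval h x))     ≡⟨ eq a x (eval g x) (eval h x) ⟩
  (a + x * eval g x) * eval h x                       ∎
  where
  open ≡-Reasoning
  eq : ∀ a x y z → a * z + (0ℤ + x * (y * z)) ≡ (a + x * y) * z
  eq = solve-∀

eval-linear : ∀ l c x y → eval (linear l c) x ≡ eval (linear l c) y + l * (x - y)
eval-linear = eq
  where
  -- This is the Horner form to which `eval (linear l c)` reduces, spelled out for the ring solver.
  eq : ∀ l c x y → c + x * (l + x * 0ℤ) ≡ (c + y * (l + y * 0ℤ)) + l * (x - y)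
  eq = solve-∀

-- Prime divisors of the values of the product.

prime∤1 : ∀ {p} → Prime p → ¬ + p ∣ 1ℤ
prime∤1 {p} pp p∣1 = ℕ.>⇒≢ (ℕ.nonTrivial⇒n>1 p {{prime⇒nonTrivial pp}}) (ℕ.∣1⇒≡1 (∣⇒∣ᵤ p∣1))

euclidℤ : ∀ {p} → Prime p → ∀ i j → + p ∣ i * j → (+ p ∣ i) ⊎ (+ p ∣ j)
euclidℤ {p} pp i j p∣ij = Sum.map ∣ᵤ⇒∣ ∣ᵤ⇒∣
  (euclidsLemma ∣ i ∣ ∣ j ∣ pp (subst (p ℕ.∣_) (abs-* i j) (∣⇒∣ᵤ p∣ij)))

prime∤coprime : ∀ {p N} → Prime p → p ℕ.∣ N → ∀ i → gcd i (+ N) ≡ 1ℤ → ¬ + p ∣ i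
prime∤coprime {p} {N} pp p∣N i gcd≡1 p∣i = prime∤1 pp
  (subst (+ p ∣_) gcd≡1 (∣ᵤ⇒∣ (gcd-greatest {i} {+ N} {+ p} (∣⇒∣ᵤ p∣i) p∣N)))

-- Euclid's lemma, by induction on the number of factors; the empty product has value 1, which no
-- prime divides.
prime∣∏ : ∀ {p} → Prime p → ∀ {d} (f : Fin d → Poly) x →
          + p ∣ eval (∏ f) x ⇔ ∃ λ i → + p ∣ eval (f i) x
prime∣∏ {p} pp f x = mk⇔ (to f) (λ (i , p∣fᵢ) → from f i p∣fᵢ)
  where
  eval-1 : ∀ x → 1ℤ + x * 0ℤ ≡ 1ℤ
  eval-1 = solve-∀
  to : ∀ {d} (f : Fin d → Poly) → + p ∣ eval (∏ f) x → ∃ λ i → + p ∣ eval (f i) x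
  to {ℕ.zero}  f p∣1 = contradiction (subst (+ p ∣_) (eval-1 x) p∣1) (prime∤1 pp)
  to {ℕ.suc d} f p∣f
    with euclidℤ pp (eval (f zero) x) _ (subst (+ p ∣_) (eval-*ₚ (f zero) (∏ (f ∘ suc)) x) p∣f)
  ... | inj₁ p∣f₀ = zero , p∣f₀
  ... | inj₂ p∣∏  = let i , p∣fᵢ = to (f ∘ suc) p∣∏ in suc i , p∣fᵢ
  from : ∀ {d} (f : Fin d → Poly) i → + p ∣ eval (f i) x → + p ∣ eval (∏ f) x
  from f zero    p∣f₀ = subst (+ p ∣_) (sym (eval-*ₚ (f zero) _ x)) (∣m⇒∣m*n _ p∣f₀)
  from f (suc i) p∣fᵢ =
    subst (+ p ∣_) (sym (eval-*ₚ (f zero) _ x)) (∣n⇒∣m*n (eval (f zero) x) (from (f ∘ suc) i p∣fᵢ))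

prime∣linear : ∀ {p N} → Prime p → p ℕ.∣ N → ∀ l c b → gcd c (+ N) ≡ 1ℤ →
               eval (linear l c) b ≡ + N → ∀ x → (+ p ∣ eval (linear l c) x) ⇔ (+ p ∣ x - b)
prime∣linear {p} {N} pp p∣N l c b c⊥N f[b]≡N x = mk⇔ to from
  where
  f = linear l c
  p∣+N : + p ∣ + N
  p∣+N = ∣ᵤ⇒∣ p∣N
  f[x]≡ : eval f x ≡ + N + l * (x - b)
  f[x]≡ = trans (eval-linear l c x b) (cong (_+ l * (x - b)) f[b]≡N)
  f≡ : ∀ l c x → c + x * (l + x * 0ℤ) ≡ c + x * l
  f≡ = solve-∀
  -- If `p` divided both `f(x) = c + x l` and `l`, it would divide `c`, which is coprime to `N`.
  p∤l : + p ∣ eval f x → ¬ + p ∣ l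
  p∤l p∣f p∣l = prime∤coprime pp p∣N c c⊥N
    (∣m+n∣n⇒∣m (subst (+ p ∣_) (f≡ l c x) p∣f) (∣n⇒∣m*n x p∣l))
  to : + p ∣ eval f x → + p ∣ x - b
  to p∣f = [ (λ p∣l → contradiction p∣l (p∤l p∣f)) , (λ p∣x-b → p∣x-b) ]′
    (euclidℤ pp l (x - b) (∣m+n∣m⇒∣n (subst (+ p ∣_) f[x]≡ p∣f) p∣+N))
  from : + p ∣ x - b → + p ∣ eval f x
  from p∣x-b = subst (+ p ∣_) (sym f[x]≡) (∣m∣n⇒∣m+n p∣+N (∣n⇒∣m*n l p∣x-b))

-- At most one factor is divisible by `p` at a given `x`, so the indicator of "some factor" is the
-- full sum of indicators, with no overlaps to correct.
[prime∣∏]≡∑ : ∀ {p N} → Prime p → p ℕ.∣ N → ∀ {d} (b l c : Fin d → ℤ) →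
              (∀ i → eval (linear (l i) (c i)) (b i) ≡ + N) →
              (∀ i → gcd (c i) (+ N) ≡ 1ℤ) →
              (∀ j k → j ≢ k → gcd (b j - b k) (+ N) ≡ 1ℤ) →
              ∀ x → [ + p ∣? eval (∏ (λ i → linear (l i) (c i))) x ] ≡ ∑[ i < d ] [ + p ∣? x - b i ]
[prime∣∏]≡∑ {p} {N} pp p∣N {d} b l c f[b]≡N c⊥N b⊥N x = begin
  [ + p ∣? eval (∏ f) x ]                          ≡⟨ []-cong (prime∣∏ pp f x) (+ p ∣? eval (∏ f) x) ∃? ⟩
  [ ∃? ]                                           ≡⟨ sym (∑-[]-unique (λ i → + p ∣? eval (f i) x) unique ∃?) ⟩
  ∑[ i < d ] [ + p ∣? eval (f i) x ]               ≡⟨ sum-cong-≗ (λ i → []-cong (root i) (+ p ∣? eval (f i) x) (+ p ∣? x - b i)) ⟩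
  ∑[ i < d ] [ + p ∣? x - b i ]                    ∎
  where
  open ≡-Reasoning
  f : Fin d → Poly
  f i = linear (l i) (c i)
  ∃? : Dec (∃ λ i → + p ∣ eval (f i) x)
  ∃? = Fin.any? λ i → + p ∣? eval (f i) x
  root : ∀ i → (+ p ∣ eval (f i) x) ⇔ (+ p ∣ x - b i)
  root i = prime∣linear pp p∣N (l i) (c i) (b i) (c⊥N i) (f[b]≡N i) x
  unique : ∀ {i j} → + p ∣ eval (f i) x → + p ∣ eval (f j) x → i ≡ j
  unique {i} {j} p∣fᵢ p∣fⱼ with i Fin.≟ j
  ... | yes i≡j = i≡j
  -- Both `b i` and `b j` would be congruent to `x`, making `p` a divisor of their difference.
  ... | no  i≢j = contradiction
    (∣-difference′ x (b i) (b j) (Equivalence.to (root i) p∣fᵢ) (Equivalence.to (root j) p∣fⱼ))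
    (prime∤coprime pp p∣N (b i - b j) (b⊥N i j i≢j))

-- Suitability in terms of the two prime divisors.

prime-coprime : ∀ {p m} → Prime p → ¬ p ℕ.∣ m → Coprime m p
prime-coprime pp p∤m (i∣m , i∣p) with prime⇒irreducible pp i∣p
... | inj₁ i≡1  = i≡1
... | inj₂ refl = contradiction i∣m p∤m

distinctPrimes-coprime : ∀ {p q} → Prime p → Prime q → p ≢ q → Coprime p q
distinctPrimes-coprime {p} {q} pp pq p≢q = prime-coprime pq λ q∣p →
  [ (λ q≡1 → prime∤1 pq (∣ᵤ⇒∣ (ℕ.∣-reflexive q≡1))) , (λ q≡p → p≢q (sym q≡p)) ]′ (prime⇒irreducible pp q∣p)

-- The gcd is a multiple of `p`, hence exceeds 1; were it `N`, then `q` would divide `m`. It is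
-- applied with the two primes in either role.
gcd-proper : ∀ {p q N} m .{{_ : ℕ.NonZero N}} → Prime p → p ℕ.∣ N → q ℕ.∣ N → p ℕ.∣ m → ¬ q ℕ.∣ m →
             1 ℕ.< ℕ.gcd m N × ℕ.gcd m N ℕ.< N
gcd-proper {p} {q} {N} m pp p∣N q∣N p∣m q∤m =
  ℕ.<-≤-trans (ℕ.nonTrivial⇒n>1 p {{prime⇒nonTrivial pp}})
    (ℕ.∣⇒≤ {{ℕ.≢-nonZero (ℕ.gcd[m,n]≢0 m N (inj₂ (ℕ.≢-nonZero⁻¹ N)))}} (ℕ.gcd-greatest p∣m p∣N)) ,
  ℕ.≤∧≢⇒< (ℕ.gcd[m,n]≤n m N)
    (λ gcd≡N → q∤m (ℕ.∣-trans (subst (q ℕ.∣_) (sym gcd≡N) q∣N) (ℕ.gcd[m,n]∣m m N)))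

-- The gcd is coprime to `p`, so as a divisor of `p q` it divides `q`; being coprime to `q` as well,
-- it is 1.
gcd≡1 : ∀ {p q} m → Prime p → Prime q → ¬ p ℕ.∣ m → ¬ q ℕ.∣ m → ℕ.gcd m (p ℕ.* q) ≡ 1
gcd≡1 {p} {q} m pp pq p∤m q∤m =
  prime-coprime pq (λ q∣g → q∤m (ℕ.∣-trans q∣g g∣m)) (ℕ.∣-refl , g∣q)
  where
  g∣m = ℕ.gcd[m,n]∣m m (p ℕ.* q)
  g∣q : ℕ.gcd m (p ℕ.* q) ℕ.∣ q
  g∣q = coprime-divisor (prime-coprime pp (λ p∣g → p∤m (ℕ.∣-trans p∣g g∣m))) (ℕ.gcd[m,n]∣n m (p ℕ.* q))

[suitable] : ∀ {p q} → Prime p → Prime q → p ≢ q → ∀ g x →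
             [ suitable? (p ℕ.* q) g x ] ℕ.+ 2 ℕ.* ([ + p ∣? eval g (+ x) ] ℕ.* [ + q ∣? eval g (+ x) ])
             ≡ [ + p ∣? eval g (+ x) ] ℕ.+ [ + q ∣? eval g (+ x) ]
[suitable] {p} {q} pp pq p≢q g x = []-exactlyOne (+ p ∣? f) (+ q ∣? f) (suitable? N g x)
  -- When both primes divide the value, so does `N`, and the gcd is not below `N`.
  (λ p∣f q∣f (_ , gcd<N) → contradiction
    (ℕ.∣⇒≤ {{ℕ.≢-nonZero (ℕ.gcd[m,n]≢0 ∣ f ∣ N (inj₂ (ℕ.≢-nonZero⁻¹ N)))}} (ℕ.gcd-greatest
      (∣⇒∣ᵤ (coprime-*-∣ (distinctPrimes-coprime pp pq p≢q) p∣f q∣f)) ℕ.∣-refl))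
    (ℕ.<⇒≱ (drop‿+<+ gcd<N)))
  (λ p∣f q∤f → proper (gcd-proper ∣ f ∣ pp (ℕ.m∣m*n q) (ℕ.n∣m*n p) (∣⇒∣ᵤ p∣f) (q∤f ∘ ∣ᵤ⇒∣)))
  (λ p∤f q∣f → proper (gcd-proper ∣ f ∣ pq (ℕ.n∣m*n p) (ℕ.m∣m*n q) (∣⇒∣ᵤ q∣f) (p∤f ∘ ∣ᵤ⇒∣)))
  (λ p∤f q∤f (1<gcd , _) → ℕ.>⇒≢ (drop‿+<+ 1<gcd) (gcd≡1 ∣ f ∣ pp pq (p∤f ∘ ∣ᵤ⇒∣) (q∤f ∘ ∣ᵤ⇒∣)))
  where
  N = p ℕ.* q
  f = eval g (+ x)
  instance
    N≢0 = ℕ.m*n≢0 p q {{prime⇒nonZero pp}} {{prime⇒nonZero pq}}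
  -- The integer gcd is by definition `+_` of the natural gcd of absolute values.
  proper : 1 ℕ.< ℕ.gcd ∣ f ∣ N × ℕ.gcd ∣ f ∣ N ℕ.< N → Suitable N g x
  proper (1<gcd , gcd<N) = +<+ 1<gcd , +<+ gcd<N

-- Summation over all residues and the final count.

∑∑-const : ∀ m d k (a : Fin d → Fin m → ℕ) → (∀ i → ∑[ x < m ] a i x ≡ k) →
           ∑[ x < m ] ∑[ i < d ] a i x ≡ d ℕ.* k
∑∑-const m d k a ∑a≡k =
  trans (∑-comm (λ x i → a i x)) (trans (sum-cong-≗ ∑a≡k) (∑-const d k))

-- The count is kept additive in `ℕ`; the term `2 d²` is subtracted only after passing to `ℤ`.
ν-count : ∀ {p q} → Prime p → Prime q → p ≢ q → ∀ {d} (b l c : Fin d → ℤ) →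
          (∀ i → eval (linear (l i) (c i)) (b i) ≡ + (p ℕ.* q)) →
          (∀ i → gcd (c i) (+ (p ℕ.* q)) ≡ 1ℤ) →
          (∀ j k → j ≢ k → gcd (b j - b k) (+ (p ℕ.* q)) ≡ 1ℤ) →
          ν (p ℕ.* q) (∏ (λ i → linear (l i) (c i))) ℕ.+ 2 ℕ.* (d ℕ.* d) ≡ d ℕ.* q ℕ.+ d ℕ.* p
ν-count {p} {q} pp pq p≢q {d} b l c f[b]≡N c⊥N b⊥N = begin
  ν N F ℕ.+ 2 ℕ.* (d ℕ.* d)
    ≡⟨ cong₂ (λ s t → s ℕ.+ 2 ℕ.* t) (length-filter-applyUpTo (suitable? N F) (λ x → x) N) (sym ∑AB) ⟩
  ∑[ x < N ] S x ℕ.+ 2 ℕ.* ∑[ x < N ] (A x ℕ.* B x)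
    ≡⟨ cong (λ z → ∑[ x < N ] S x ℕ.+ z) (*-distribˡ-sum 2 (λ x → A x ℕ.* B x)) ⟩
  ∑[ x < N ] S x ℕ.+ ∑[ x < N ] (2 ℕ.* (A x ℕ.* B x))
    ≡⟨ sym (∑-distrib-+ S (λ x → 2 ℕ.* (A x ℕ.* B x))) ⟩
  ∑[ x < N ] (S x ℕ.+ 2 ℕ.* (A x ℕ.* B x))
    ≡⟨ sum-cong-≗ {N} (λ x → [suitable] pp pq p≢q F (toℕ x)) ⟩
  ∑[ x < N ] (A x ℕ.+ B x)
    ≡⟨ ∑-distrib-+ A B ⟩
  ∑[ x < N ] A x ℕ.+ ∑[ x < N ] B x
    ≡⟨ cong₂ ℕ._+_ ∑A ∑B ⟩
  d ℕ.* q ℕ.+ d ℕ.* p ∎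
  where
  open ≡-Reasoning
  instance
    p≢0 = prime⇒nonZero pp
    q≢0 = prime⇒nonZero pq
    N≢0 = ℕ.m*n≢0 p q
  N = p ℕ.* q
  F = ∏ (λ i → linear (l i) (c i))
  S A B : Fin N → ℕ
  S x = [ suitable? N F (toℕ x) ]
  A x = [ + p ∣? eval F (+ toℕ x) ]
  B x = [ + q ∣? eval F (+ toℕ x) ]
  α β : Fin d → Fin N → ℕ
  α i x = [ + p ∣? + toℕ x - b i ]
  β i x = [ + q ∣? + toℕ x - b i ]
  A≡ : ∀ x → A x ≡ ∑[ i < d ] α i x
  A≡ x = [prime∣∏]≡∑ pp (ℕ.m∣m*n q) b l c f[b]≡N c⊥N b⊥N (+ toℕ x)
  B≡ : ∀ x → B x ≡ ∑[ i < d ] β i x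
  B≡ x = [prime∣∏]≡∑ pq (ℕ.n∣m*n p) b l c f[b]≡N c⊥N b⊥N (+ toℕ x)
  ∑A : ∑[ x < N ] A x ≡ d ℕ.* q
  -- `∑-multiples q p` runs over `q ℕ.* p`, so the range is transported to `p ℕ.* q`.
  ∑A = trans (sum-cong-≗ A≡) (∑∑-const N d q α λ i →
    subst (λ n → ∑[ x < n ] [ + p ∣? + toℕ x - b i ] ≡ q) (ℕ.*-comm q p) (∑-multiples q p (b i)))
  ∑B : ∑[ x < N ] B x ≡ d ℕ.* p
  ∑B = trans (sum-cong-≗ B≡) (∑∑-const N d p β λ i → ∑-multiples p q (b i))
  ∑AB : ∑[ x < N ] (A x ℕ.* B x) ≡ d ℕ.* d
  ∑AB = begin
    ∑[ x < N ] (A x ℕ.* B x)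
      ≡⟨ sum-cong-≗ (λ x → trans (cong₂ ℕ._*_ (A≡ x) (B≡ x)) (∑-product d d (λ i → α i x) (λ j → β j x))) ⟩
    ∑[ x < N ] ∑[ i < d ] ∑[ j < d ] (α i x ℕ.* β j x)
      -- Each pair `(i , j)`, including `i = j`, has exactly one common solution below `N`. The
      -- inner sum gives `d ℕ.* 1` for each `i`.
      ≡⟨ ∑∑-const N d d (λ i x → ∑[ j < d ] (α i x ℕ.* β j x)) (λ i →
           trans (∑∑-const N d 1 (λ j x → α i x ℕ.* β j x) λ j →
                   ∑-simultaneous (distinctPrimes-coprime pp pq p≢q) (b i) (b j))
                 (ℕ.*-identityʳ d)) ⟩
    d ℕ.* d ∎

theorem2p9 : (N p q : ℕ) → Prime p → Prime q → p ≢ q → N ≡ p ℕ.* q →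
    (d : ℕ) (b l c : Fin d → ℤ) →
    (∀ i → HasDegree (linear (l i) (c i)) 1) →
    (∀ i → eval (linear (l i) (c i)) (b i) ≡ + N) →
    (∀ i → gcd (c i) (+ N) ≡ 1ℤ) →
    (∀ j k → j ≢ k → gcd (b j - b k) (+ N) ≡ 1ℤ) →
    + ν N (∏ (λ i → linear (l i) (c i))) ≡ + d * + p + + d * + q - + 2 * (+ d) ^ 2
theorem2p9 _ p q pp pq p≢q refl d b l c _ f[b]≡N c⊥N b⊥N = begin
  + n                                                ≡⟨ eq₁ (+ n) (+ 2 * (+ d * + d)) ⟩
  (+ n + + 2 * (+ d * + d)) - + 2 * (+ d * + d)      ≡⟨ cong (_- + 2 * (+ d * + d)) cast ⟩
  (+ d * + q + + d * + p) - + 2 * (+ d * + d)        ≡⟨ eq₂ (+ d) (+ p) (+ q) ⟩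
  + d * + p + + d * + q - + 2 * (+ d) ^ 2            ∎
  where
  open ≡-Reasoning
  n = ν (p ℕ.* q) (∏ (λ i → linear (l i) (c i)))
  eq₁ : ∀ n k → n ≡ (n + k) - k
  eq₁ = solve-∀
  -- The last factor `d * (d * 1ℤ)` is what `(+ d) ^ 2` reduces to.
  eq₂ : ∀ d p q → (d * q + d * p) - + 2 * (d * d) ≡ d * p + d * q - + 2 * (d * (d * 1ℤ))
  eq₂ = solve-∀
  cast : + n + + 2 * (+ d * + d) ≡ + d * + q + + d * + p
  cast = begin
    + n + + 2 * (+ d * + d)           ≡⟨ cong (λ z → + n + + 2 * z) (sym (pos-* d d)) ⟩
    + n + + 2 * + (d ℕ.* d)           ≡⟨ cong (λ z → + n + z) (sym (pos-* 2 (d ℕ.* d))) ⟩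
    -- Sums of the form `+ m + + k` reduce to `+ (m ℕ.+ k)`, so only products need an explicit cast.
    + (n ℕ.+ 2 ℕ.* (d ℕ.* d))         ≡⟨ cong +_ (ν-count pp pq p≢q b l c f[b]≡N c⊥N b⊥N) ⟩
    + (d ℕ.* q) + + (d ℕ.* p)         ≡⟨ cong₂ _+_ (pos-* d q) (pos-* d p) ⟩
    + d * + q + + d * + p             ∎
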